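{- Let $\mathrm{CL}_3(\wedge^\bullet,\vee^\bullet)$ be the extension of $\mathrm{CL}_3$ with binary connectives $\wedge^\bullet,\vee^\bullet$ (full left-sequential conjunction and disjunction) and their defining axioms $$x\wedge^\bullet y=(x\wedge y)\vee(y\wedge x),\qquad x\vee^\bullet y=\neg(\neg x\wedge^\bullet\neg y),$$ and define $\mathrm{CL}_2(\wedge^\bullet,\vee^\bullet)$ and $\mathrm{CL}(\wedge^\bullet,\vee^\bullet)$ as the extensions of $\mathrm{CL}_2$ and $\mathrm{CL}$ in the same way. Then $\mathrm{CL}_3(\wedge^\bullet,\vee^\bullet)$ incorporates Bochvar's three-valued strict logic, in the sense that all of the following equations (which completely axiomatise that logic) are derivable from $\mathrm{CL}_3(\wedge^\bullet,\vee^\bullet)$: (S1) $\neg\mathsf T=\mathsf F$; (S2) $\neg\mathsf U=\mathsf U$; (S3) $\neg\neg x=x$; (S4) $\neg(x\wedge^\bullet y)=\neg x\vee^\bullet\neg y$; (S6) $(x\wedge^\bullet y)\wedge^\bullet z=x\wedge^\bullet(y\wedge^\bullet z)$; (S7) $\mathsf T\wedge^\bullet x=x$; (S8) $x\vee^\bullet(\neg x\wedge^\bullet y)=x\vee^\bullet y$; (S9) $x\wedge^\bullet y=y\wedge^\bullet x$; (S10) $x\wedge^\bullet(y\vee^\bullet z)=(x\wedge^\bullet y)\vee^\bullet(x\wedge^\bullet z)$; (S11) $\mathsf U\wedge^\bullet x=\mathsf U$. Moreover, (S1), (S3), (S4), (S6), (S7), (S8), (S9) are derivable from $\mathrm{CL}_2(\wedge^\bullet,\vee^\bullet)$,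 and (S3), (S4), (S8), (S9), (S10) are derivable from $\mathrm{CL}(\wedge^\bullet,\vee^\bullet)$.
   Context: Derivability is in equational logic. $\wedge,\vee$ denote the (noncommutative) short-circuit conjunction and disjunction. $\mathrm{CL}$ (conditional logic of Guzmán and Squier) is the equational theory over $\{\neg,\wedge,\vee\}$ axiomatised by $\neg\neg x=x$; $\neg(x\wedge y)=\neg x\vee\neg y$; $(x\wedge y)\wedge z=x\wedge(y\wedge z)$; $x\wedge(y\vee z)=(x\wedge y)\vee(x\wedge z)$; $(x\vee y)\wedge z=(x\wedge z)\vee(\neg x\wedge y\wedge z)$ (bracketing immaterial by associativity); $x\vee(x\wedge y)=x$; $(x\wedge y)\vee(y\wedge x)=(y\wedge x)\vee(x\wedge y)$. $\mathrm{CL}_2$ adds constants $\mathsf T,\mathsf F$ and the axioms $\mathsf T\wedge x=x$, $\neg\mathsf T=\mathsf F$. $\mathrm{CL}_3$ adds to $\mathrm{CL}_2$ the constant $\mathsf U$ and the axiom $\neg\mathsf U=\mathsf U$. Bochvar's three-valued strict logic has truth values $\mathsf T,\mathsf F,\mathsf U$, where each connective returns $\mathsf U$ as soon as some argument is $\mathsf U$ and otherwise is the classical one. -}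

module Defs where

open import Data.Bool as Bool using (Bool; true; false; not)
open import Data.Empty using (⊥)
open import Data.Maybe using (Maybe; just; nothing; map; zipWith)
open import Data.Nat using (ℕ)
open import Relation.Binary.PropositionalEquality using (_≡_)

infix  3 _⊢_
infix  4 _≈_
infixr 6 _∨_ _∨•_
infixr 7 _∧_ _∧•_
infix  8 ¬_

-- All signatures in play consist of constants C, the unary ¬ and binary
-- connectives B.
data Term (C B : Set) : Set where
  var : ℕ → Term C B
  con : C → Term C B
  ¬_  : Term C B → Term C B
  bin : B → Term C B → Term C B → Term C B

_[_] : ∀ {C B} → Term C B → (ℕ → Term C B) → Term C B
var i     [ σ ] = σ i
con c     [ σ ] = con c
(¬ s)     [ σ ] = ¬ (s [ σ ])
bin b s t [ σ ] = bin b (s [ σ ]) (t [ σ ])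

record Equation (C B : Set) : Set where
  constructor _≈_
  field
    lhs rhs : Term C B

Theory : Set → Set → Set₁
Theory C B = Equation C B → Set

data _⊢_ {C B : Set} (Th : Theory C B) : Equation C B → Set where
  axiom     : ∀ {e} → Th e → Th ⊢ e
  ≈-refl    : ∀ {s} → Th ⊢ s ≈ s
  ≈-sym     : ∀ {s t} → Th ⊢ s ≈ t → Th ⊢ t ≈ s
  ≈-trans   : ∀ {s t r} → Th ⊢ s ≈ t → Th ⊢ t ≈ r → Th ⊢ s ≈ r
  ¬-cong    : ∀ {s t} → Th ⊢ s ≈ t → Th ⊢ ¬ s ≈ ¬ t
  bin-cong  : ∀ b {s s′ t t′} → Th ⊢ s ≈ s′ → Th ⊢ t ≈ t′ →
              Th ⊢ bin b s t ≈ bin b s′ t′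
  instanceOf : ∀ {s t} → Th ⊢ s ≈ t → (σ : ℕ → Term C B) →
              Th ⊢ s [ σ ] ≈ t [ σ ]

data Const₂ : Set where
  t f : Const₂

data Const₃ : Set where
  t f u : Const₃

data Sequential : Set where
  and or : Sequential

data FullSequential : Set where
  and• or• : FullSequential

data AllConnectives : Set where
  and or and• or• : AllConnectives

-- Inclusions of symbol sets, so that an axiom is written once and read in
-- every signature that has its symbols.  The instances below are the only
-- ones.
record _⊑_ (A B : Set) : Set where
  field
    embed : A → B
open _⊑_ ⦃ ... ⦄

instance
  const₂⊑const₂ : Const₂ ⊑ Const₂
  const₂⊑const₂ .embed c = c

  const₂⊑const₃ : Const₂ ⊑ Const₃
  const₂⊑const₃ .embed t = t
  const₂⊑const₃ .embed f = f

  seq⊑seq : Sequential ⊑ Sequential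
  seq⊑seq .embed b = b

  seq⊑all : Sequential ⊑ AllConnectives
  seq⊑all .embed and = and
  seq⊑all .embed or  = or

  full⊑full : FullSequential ⊑ FullSequential
  full⊑full .embed b = b

  full⊑all : FullSequential ⊑ AllConnectives
  full⊑all .embed and• = and•
  full⊑all .embed or•  = or•

T F : ∀ {C B} → ⦃ Const₂ ⊑ C ⦄ → Term C B
T = con (embed {A = Const₂} t)
F = con (embed {A = Const₂} f)

U : ∀ {B} → Term Const₃ B
U = con u

_∧_ _∨_ : ∀ {C B} → ⦃ Sequential ⊑ B ⦄ → Term C B → Term C B → Term C B
_∧_ = bin (embed {A = Sequential} and)
_∨_ = bin (embed {A = Sequential} or)

_∧•_ _∨•_ : ∀ {C B} → ⦃ FullSequential ⊑ B ⦄ → Term C B → Term C B → Term C B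
_∧•_ = bin (embed {A = FullSequential} and•)
_∨•_ = bin (embed {A = FullSequential} or•)

x y z : ∀ {C B} → Term C B
x = var 0
y = var 1
z = var 2

data CL {C B : Set} ⦃ _ : Sequential ⊑ B ⦄ : Theory C B where
  involution  : CL (¬ ¬ x ≈ x)
  deMorgan    : CL (¬ (x ∧ y) ≈ ¬ x ∨ ¬ y)
  ∧-assoc     : CL ((x ∧ y) ∧ z ≈ x ∧ (y ∧ z))
  ∧-distribˡ  : CL (x ∧ (y ∨ z) ≈ (x ∧ y) ∨ (x ∧ z))
  ∧-distribʳ  : CL ((x ∨ y) ∧ z ≈ (x ∧ z) ∨ (¬ x ∧ (y ∧ z)))
  ∨-absorbs-∧ : CL (x ∨ (x ∧ y) ≈ x)
  ∧∨-comm     : CL ((x ∧ y) ∨ (y ∧ x) ≈ (y ∧ x) ∨ (x ∧ y))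

data CL₂ {C B : Set} ⦃ _ : Const₂ ⊑ C ⦄ ⦃ _ : Sequential ⊑ B ⦄ : Theory C B where
  cl          : ∀ {e} → CL e → CL₂ e
  ∧-identityˡ : CL₂ (T ∧ x ≈ x)
  ¬T          : CL₂ (¬ T ≈ F)

data CL₃ {B : Set} ⦃ _ : Sequential ⊑ B ⦄ : Theory Const₃ B where
  cl₂ : ∀ {e} → CL₂ e → CL₃ e
  ¬U  : CL₃ (¬ U ≈ U)

data _⟨∧•,∨•⟩ {C : Set} (Th : Theory C AllConnectives) : Theory C AllConnectives where
  base   : ∀ {e} → Th e → (Th ⟨∧•,∨•⟩) e
  ∧•-def : (Th ⟨∧•,∨•⟩) (x ∧• y ≈ (x ∧ y) ∨ (y ∧ x))
  ∨•-def : (Th ⟨∧•,∨•⟩) (x ∨• y ≈ ¬ (¬ x ∧• ¬ y))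

CL⟨∧•,∨•⟩ : Theory ⊥ AllConnectives
CL⟨∧•,∨•⟩ = CL ⟨∧•,∨•⟩

CL₂⟨∧•,∨•⟩ : Theory Const₂ AllConnectives
CL₂⟨∧•,∨•⟩ = CL₂ ⟨∧•,∨•⟩

CL₃⟨∧•,∨•⟩ : Theory Const₃ AllConnectives
CL₃⟨∧•,∨•⟩ = CL₃ ⟨∧•,∨•⟩

S1 : ∀ {C B} → ⦃ Const₂ ⊑ C ⦄ → Equation C B
S1 = ¬ T ≈ F

S2 : ∀ {B} → Equation Const₃ B
S2 = ¬ U ≈ U

S3 : ∀ {C B} → Equation C B
S3 = ¬ ¬ x ≈ x

S4 S6 S8 S9 S10 : ∀ {C B} → ⦃ FullSequential ⊑ B ⦄ → Equation C B
S4  = ¬ (x ∧• y) ≈ ¬ x ∨• ¬ y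
S6  = (x ∧• y) ∧• z ≈ x ∧• (y ∧• z)
S8  = x ∨• (¬ x ∧• y) ≈ x ∨• y
S9  = x ∧• y ≈ y ∧• x
S10 = x ∧• (y ∨• z) ≈ (x ∧• y) ∨• (x ∧• z)

S7 : ∀ {C B} → ⦃ Const₂ ⊑ C ⦄ → ⦃ FullSequential ⊑ B ⦄ → Equation C B
S7 = T ∧• x ≈ x

S11 : ∀ {B} → ⦃ FullSequential ⊑ B ⦄ → Equation Const₃ B
S11 = U ∧• x ≈ U

data StrictAxioms : Theory Const₃ FullSequential where
  s1  : StrictAxioms S1
  s2  : StrictAxioms S2
  s3  : StrictAxioms S3
  s4  : StrictAxioms S4
  s6  : StrictAxioms S6
  s7  : StrictAxioms S7
  s8  : StrictAxioms S8
  s9  : StrictAxioms S9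
  s10 : StrictAxioms S10
  s11 : StrictAxioms S11

-- Bochvar's truth values: nothing is U, so map and zipWith are exactly the
-- strict extensions of the classical truth functions.
Value : Set
Value = Maybe Bool

⟦_⟧ : Term Const₃ FullSequential → (ℕ → Value) → Value
⟦ var i ⟧        ρ = ρ i
⟦ con t ⟧        ρ = just true
⟦ con f ⟧        ρ = just false
⟦ con u ⟧        ρ = nothing
⟦ ¬ s ⟧          ρ = map not (⟦ s ⟧ ρ)
⟦ bin and• s r ⟧ ρ = zipWith Bool._∧_ (⟦ s ⟧ ρ) (⟦ r ⟧ ρ)
⟦ bin or• s r ⟧  ρ = zipWith Bool._∨_ (⟦ s ⟧ ρ) (⟦ r ⟧ ρ)

BochvarValid : Equation Const₃ FullSequential → Set
BochvarValid (s ≈ r) = ∀ ρ → ⟦ s ⟧ ρ ≡ ⟦ r ⟧ ρ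

{-# OPTIONS --safe #-}
module Submission where

open import Data.Bool using (Bool; true; false; not)
import Data.Bool as Bool
import Data.Bool.Properties as Bool
open import Data.List using (List; []; _∷_; _++_; map)
open import Data.List.Membership.Propositional using (_∈_)
open import Data.List.Membership.Propositional.Properties
  using (∈-++⁺ˡ; ∈-++⁺ʳ; ∈-++⁻)
open import Data.List.Relation.Binary.Subset.Propositional using (_⊆_)
open import Data.List.Relation.Unary.Any using (here; there)
open import Data.Maybe using (just; nothing; zipWith)
import Data.Maybe as Maybe
open import Data.Nat using (ℕ; zero; suc; _≟_)
open import Data.Product using (_×_; _,_; proj₁)
open import Data.Sum using (_⊎_; inj₁; inj₂)
open import Function using (_∘_; id)
open import Function.Bundles using (_⇔_; mk⇔)
open import Relation.Binary using (IsEquivalence; Setoid)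
open import Relation.Binary.PropositionalEquality as ≡ using (_≡_)
import Relation.Binary.Reasoning.Setoid as SetoidReasoning
open import Relation.Nullary using (yes; no; contradiction)
open import Defs

-- CL is the theory of C-algebras, a self-dual class of structures.  There the
-- term d a = a ∨ ¬a records whether a is defined: it commutes with its kind and
-- (x ∧ y) ∨ (y ∧ x) = d y ∧ x ∧ y.  Since d is multiplicative on full
-- connectives, every claim about ∧• and ∨• becomes an identity between terms
-- guarded by products of d's, whose inner repeated guards can be deleted.
-- For the completeness of the strict axioms: under a conjunction of literals
-- fixing all its variables, a term equals the constant it evaluates to, so
-- valid equations hold under the product of all x ∨ ¬x; that product is absorbed
-- by both sides since they are undefined as soon as one of these variables is.

-- C-algebras

record CAlgebra : Set₁ where
  infix  4 _≋_
  infixr 6 _+_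
  infixr 7 _∙_
  infix  8 _′
  field
    Carrier       : Set
    _≋_           : Carrier → Carrier → Set
    _′            : Carrier → Carrier
    _∙_ _+_       : Carrier → Carrier → Carrier
    isEquivalence : IsEquivalence _≋_
    ′-cong        : ∀ {a b} → a ≋ b → a ′ ≋ b ′
    ∙-cong        : ∀ {a b c d} → a ≋ b → c ≋ d → a ∙ c ≋ b ∙ d
    +-cong        : ∀ {a b c d} → a ≋ b → c ≋ d → a + c ≋ b + d
    ′-involutive  : ∀ a → a ′ ′ ≋ a
    ′-∙           : ∀ a b → (a ∙ b) ′ ≋ a ′ + b ′
    ∙-assoc       : ∀ a b c → (a ∙ b) ∙ c ≋ a ∙ (b ∙ c)
    ∙-distribˡ-+  : ∀ a b c → a ∙ (b + c) ≋ (a ∙ b) + (a ∙ c)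
    ∙-distribʳ-+  : ∀ a b c → (a + b) ∙ c ≋ (a ∙ c) + (a ′ ∙ (b ∙ c))
    +-absorbs-∙   : ∀ a b → a + (a ∙ b) ≋ a
    ∙+-comm       : ∀ a b → (a ∙ b) + (b ∙ a) ≋ (b ∙ a) + (a ∙ b)

  open IsEquivalence isEquivalence public

  setoid : Setoid _ _
  setoid = record { isEquivalence = isEquivalence }

  ∙-congˡ : ∀ {a b c} → b ≋ c → a ∙ b ≋ a ∙ c
  ∙-congˡ = ∙-cong refl

  ∙-congʳ : ∀ {a b c} → b ≋ c → b ∙ a ≋ c ∙ a
  ∙-congʳ p = ∙-cong p refl

  +-congˡ : ∀ {a b c} → b ≋ c → a + b ≋ a + c
  +-congˡ = +-cong refl

  +-congʳ : ∀ {a b c} → b ≋ c → b + a ≋ c + a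
  +-congʳ p = +-cong p refl

  ′-injective : ∀ {a b} → a ′ ≋ b ′ → a ≋ b
  ′-injective p = trans (sym (′-involutive _)) (trans (′-cong p) (′-involutive _))

-- Once de Morgan for `+` is known, negation carries the dual axioms to the original ones at negated
-- variables. Every law below is thus available with `∙` and `+` exchanged.
dual : CAlgebra → CAlgebra
dual A = record
  { _≋_ = _≋_ ; _′ = _′ ; _∙_ = _+_ ; _+_ = _∙_
  ; isEquivalence = isEquivalence
  ; ′-cong = ′-cong ; ∙-cong = +-cong ; +-cong = ∙-cong
  ; ′-involutive = ′-involutive
  ; ′-∙          = λ a b → ⌊+⌋ refl refl
  ; ∙-assoc      = λ a b c → viaNegation (⌊+⌋ (⌊+⌋ refl refl) refl)
                     (∙-assoc _ _ _) (⌊+⌋ refl (⌊+⌋ refl refl))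
  ; ∙-distribˡ-+ = λ a b c → viaNegation (⌊+⌋ refl (⌊∙⌋ refl refl))
                     (∙-distribˡ-+ _ _ _) (⌊∙⌋ (⌊+⌋ refl refl) (⌊+⌋ refl refl))
  ; ∙-distribʳ-+ = λ a b c → viaNegation (⌊+⌋ (⌊∙⌋ refl refl) refl)
                     (∙-distribʳ-+ _ _ _)
                     (⌊∙⌋ (⌊+⌋ refl refl) (⌊+⌋ refl (⌊+⌋ refl refl)))
  ; +-absorbs-∙  = λ a b → viaNegation (⌊∙⌋ refl (⌊+⌋ refl refl))
                     (+-absorbs-∙ _ _) refl
  ; ∙+-comm      = λ a b → viaNegation (⌊∙⌋ (⌊+⌋ refl refl) (⌊+⌋ refl refl))
                     (∙+-comm _ _) (⌊∙⌋ (⌊+⌋ refl refl) (⌊+⌋ refl refl))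
  }
  where
  open CAlgebra A

  ⌊∙⌋ : ∀ {a b c d} → a ′ ≋ c → b ′ ≋ d → (a ∙ b) ′ ≋ c + d
  ⌊∙⌋ p q = trans (′-∙ _ _) (+-cong p q)

  ⌊+⌋ : ∀ {a b c d} → a ′ ≋ c → b ′ ≋ d → (a + b) ′ ≋ c ∙ d
  ⌊+⌋ p q = trans (′-cong (+-cong (sym (′-involutive _)) (sym (′-involutive _))))
    (trans (′-cong (sym (′-∙ _ _))) (trans (′-involutive _) (∙-cong p q)))

  viaNegation : ∀ {a b c d} → a ′ ≋ c → c ≋ d → b ′ ≋ d → a ≋ b
  viaNegation p q r = ′-injective (trans p (trans q (sym r)))

-- Contradictions, excluded middles and left regularity

module Basic (A : CAlgebra) where
  open CAlgebra A
  open CAlgebra (dual A) using () renaming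
    ( ′-∙          to ′-+
    ; ∙-assoc      to +-assoc
    ; ∙-distribˡ-+ to +-distribˡ-∙
    ; ∙-distribʳ-+ to +-distribʳ-∙
    ; +-absorbs-∙  to ∙-absorbs-+
    ; ∙+-comm      to +∙-comm )
  open SetoidReasoning setoid

  +-idem : ∀ a → a + a ≋ a
  +-idem a = begin
    a + a            ≈⟨ +-congˡ (∙-absorbs-+ a a) ⟨
    a + a ∙ (a + a)  ≈⟨ +-absorbs-∙ a (a + a) ⟩
    a                ∎

  ∙-idem : ∀ a → a ∙ a ≋ a
  ∙-idem a = begin
    a ∙ a            ≈⟨ ∙-congˡ (+-absorbs-∙ a a) ⟨
    a ∙ (a + a ∙ a)  ≈⟨ ∙-absorbs-+ a (a ∙ a) ⟩
    a                ∎

  ∙-∙-absorb : ∀ a b → a ∙ (a ∙ b) ≋ a ∙ b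
  ∙-∙-absorb a b = trans (sym (∙-assoc a a b)) (∙-congʳ (∙-idem a))

  +-+-absorb : ∀ a b → a + (a + b) ≋ a + b
  +-+-absorb a b = trans (sym (+-assoc a a b)) (+-congʳ (+-idem a))

  [a+b]∙a : ∀ a b → (a + b) ∙ a ≋ a + b ∙ a
  [a+b]∙a a b = begin
    (a + b) ∙ a        ≈⟨ ∙-congˡ (+-idem a) ⟨
    (a + b) ∙ (a + a)  ≈⟨ +-distribˡ-∙ a b a ⟨
    a + b ∙ a          ∎

  -- The dual of right distributivity reads `a ∙ b + c ≋ (a + c) ∙ (a ′ + (b + c))`; here all its
  -- variables are `a`, and idempotence clears both sides.
  a∙[a′+a] : ∀ a → a ∙ (a ′ + a) ≋ a
  a∙[a′+a] a = begin
    a ∙ (a ′ + a)              ≈⟨ ∙-cong (+-idem a) (+-congˡ (+-idem a)) ⟨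
    (a + a) ∙ (a ′ + (a + a))  ≈⟨ +-distribʳ-∙ a a a ⟨
    a ∙ a + a                  ≈⟨ +-congʳ (∙-idem a) ⟩
    a + a                      ≈⟨ +-idem a ⟩
    a                          ∎

  -- The two orders enter the commutativity axiom together, as `(a + a ′) ∙ (a ′ + a)`. By `lemma`
  -- such a product equals its left factor, so exchanging the factors exchanges the orders.
  +-excluded-comm : ∀ a → a + a ′ ≋ a ′ + a
  +-excluded-comm a = begin
    a + a ′                    ≈⟨ lemma a ⟨
    (a + a ′) ∙ (a ′ + a)      ≈⟨ +∙-comm a (a ′) ⟩
    (a ′ + a) ∙ (a + a ′)      ≈⟨ ∙-cong (+-congˡ (′-involutive a)) (+-congʳ (′-involutive a)) ⟨
    (a ′ + a ′ ′) ∙ (a ′ ′ + a ′)  ≈⟨ lemma (a ′) ⟩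
    a ′ + a ′ ′                ≈⟨ +-congˡ (′-involutive a) ⟩
    a ′ + a                    ∎
    where
    lemma : ∀ a → (a + a ′) ∙ (a ′ + a) ≋ a + a ′
    lemma a = begin
      (a + a ′) ∙ (a ′ + a)                        ≈⟨ ∙-distribʳ-+ a (a ′) (a ′ + a) ⟩
      a ∙ (a ′ + a) + a ′ ∙ (a ′ ∙ (a ′ + a))      ≈⟨ +-cong (a∙[a′+a] a) (∙-∙-absorb (a ′) _) ⟩
      a + a ′ ∙ (a ′ + a)                          ≈⟨ +-congˡ (∙-absorbs-+ (a ′) a) ⟩
      a + a ′                                      ∎

  a∙[a′+ab] : ∀ a b → a ∙ (a ′ + a ∙ b) ≋ a ∙ b
  a∙[a′+ab] a b = begin
    a ∙ (a ′ + a ∙ b)                            ≈⟨ ∙-cong (+-absorbs-∙ a b) (+-congˡ (+-idem _)) ⟨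
    (a + a ∙ b) ∙ (a ′ + (a ∙ b + a ∙ b))        ≈⟨ +-distribʳ-∙ a (a ∙ b) (a ∙ b) ⟨
    a ∙ (a ∙ b) + a ∙ b                          ≈⟨ +-congʳ (∙-∙-absorb a b) ⟩
    a ∙ b + a ∙ b                                ≈⟨ +-idem _ ⟩
    a ∙ b                                        ∎

  -- De Morgan and distributivity turn the left side into the negation of `a ∙ (a ′ + a)`, which is
  -- `a`.
  a′+aa′ : ∀ a → a ′ + a ∙ a ′ ≋ a ′
  a′+aa′ a = begin
    a ′ + a ∙ a ′        ≈⟨ [a+b]∙a (a ′) a ⟨
    (a ′ + a) ∙ a ′      ≈⟨ ∙-congʳ (+-congˡ (′-involutive a)) ⟨
    (a ′ + a ′ ′) ∙ a ′  ≈⟨ ∙-congʳ (′-∙ a (a ′)) ⟨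
    (a ∙ a ′) ′ ∙ a ′    ≈⟨ ′-+ (a ∙ a ′) a ⟨
    (a ∙ a ′ + a) ′      ≈⟨ ′-cong (+-congˡ (∙-idem a)) ⟨
    (a ∙ a ′ + a ∙ a) ′  ≈⟨ ′-cong (∙-distribˡ-+ a (a ′) a) ⟨
    (a ∙ (a ′ + a)) ′    ≈⟨ ′-cong (a∙[a′+a] a) ⟩
    a ′                  ∎

  -- A contradiction is false or undefined, so nothing after it is evaluated. Unfolding by
  -- `a∙[a′+ab]` and distributing produces `a ′ + a ′ ∙ b`, where absorption deletes `b`.
  contradiction-zeroˡ : ∀ a b → a ∙ (a ′ ∙ b) ≋ a ∙ a ′
  contradiction-zeroˡ a b = begin
    a ∙ (a ′ ∙ b)                        ≈⟨ a∙[a′+ab] a (a ′ ∙ b) ⟨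
    a ∙ (a ′ + a ∙ (a ′ ∙ b))            ≈⟨ ∙-congˡ (+-distribˡ-∙ (a ′) a (a ′ ∙ b)) ⟩
    a ∙ ((a ′ + a) ∙ (a ′ + a ′ ∙ b))    ≈⟨ ∙-congˡ (∙-congˡ (+-absorbs-∙ (a ′) b)) ⟩
    a ∙ ((a ′ + a) ∙ a ′)                ≈⟨ ∙-congˡ ([a+b]∙a (a ′) a) ⟩
    a ∙ (a ′ + a ∙ a ′)                  ≈⟨ ∙-congˡ (a′+aa′ a) ⟩
    a ∙ a ′                              ∎

  -- Written as a product, the left side is an instance of the commutativity axiom for `a + b` and
  -- `a`. The exchanged product factors as `a + b ∙ (b + a)`, to which absorption applies.
  a+[b+ab] : ∀ a b → a + (b + a ∙ b) ≋ a + b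
  a+[b+ab] a b = begin
    a + (b + a ∙ b)                        ≈⟨ +-congˡ ([a+b]∙a b a) ⟨
    a + (b + a) ∙ b                        ≈⟨ +-distribˡ-∙ a (b + a) b ⟩
    (a + (b + a)) ∙ (a + b)                ≈⟨ ∙-cong (+-assoc a b a) (+-+-absorb a b) ⟨
    ((a + b) + a) ∙ (a + (a + b))          ≈⟨ +∙-comm (a + b) a ⟩
    (a + (a + b)) ∙ ((a + b) + a)          ≈⟨ ∙-cong (+-+-absorb a b) (+-assoc a b a) ⟩
    (a + b) ∙ (a + (b + a))                ≈⟨ +-distribˡ-∙ a b (b + a) ⟨
    a + b ∙ (b + a)                        ≈⟨ +-congˡ (∙-absorbs-+ b a) ⟩
    a + b                                  ∎

  -- Left regularity. Absorption writes the last `a` as `a ∙ (a + b)`, the shape that `a+[b+ab]`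
  -- deletes. The dual law removes repeated guards from products.
  +-+-absorbʳ : ∀ a b → a + (b + a) ≋ a + b
  +-+-absorbʳ a b = begin
    a + (b + a)                      ≈⟨ +-+-absorb a (b + a) ⟨
    a + (a + (b + a))                ≈⟨ +-congˡ (+-assoc a b a) ⟨
    a + ((a + b) + a)                ≈⟨ +-congˡ (+-congˡ (∙-absorbs-+ a b)) ⟨
    a + ((a + b) + a ∙ (a + b))      ≈⟨ a+[b+ab] a (a + b) ⟩
    a + (a + b)                      ≈⟨ +-+-absorb a b ⟩
    a + b                            ∎

  ∙-excluded-expand : ∀ a b → (a + a ′) ∙ b ≋ a ∙ b + a ′ ∙ b
  ∙-excluded-expand a b =
    trans (∙-distribʳ-+ a (a ′) b) (+-congˡ (∙-∙-absorb (a ′) b))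

  contradiction-comm : ∀ a → a ∙ a ′ ≋ a ′ ∙ a
  contradiction-comm a = ′-injective (begin
    (a ∙ a ′) ′  ≈⟨ ′-∙ a (a ′) ⟩
    a ′ + a ′ ′  ≈⟨ +-excluded-comm (a ′) ⟩
    a ′ ′ + a ′  ≈⟨ ′-∙ (a ′) a ⟨
    (a ′ ∙ a) ′  ∎)

  -- Both sides equal `a ∙ b + a ∙ a ′`: the left by dual right distributivity, once `a ∙ a ′` has
  -- been inserted into both factors; the right by expanding `(a + a) ∙ b`, whose second summand is
  -- a contradiction.
  a∙[a′+b] : ∀ a b → a ∙ (a ′ + b) ≋ a ∙ b
  a∙[a′+b] a b = begin
    a ∙ (a ′ + b)                              ≈⟨ ∙-cong (+-absorbs-∙ a (a ′)) lemma ⟨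
    (a + a ∙ a ′) ∙ (a ′ + (b + a ∙ a ′))      ≈⟨ +-distribʳ-∙ a b (a ∙ a ′) ⟨
    a ∙ b + a ∙ a ′                            ≈⟨ +-congˡ a′ab ⟨
    a ∙ b + a ′ ∙ (a ∙ b)                      ≈⟨ ∙-distribʳ-+ a a b ⟨
    (a + a) ∙ b                                ≈⟨ ∙-congʳ (+-idem a) ⟩
    a ∙ b                                      ∎
    where
    lemma : a ′ + (b + a ∙ a ′) ≋ a ′ + b
    lemma = begin
      a ′ + (b + a ∙ a ′)                  ≈⟨ +-congʳ (a′+aa′ a) ⟨
      (a ′ + a ∙ a ′) + (b + a ∙ a ′)      ≈⟨ +-assoc _ _ _ ⟩
      a ′ + (a ∙ a ′ + (b + a ∙ a ′))      ≈⟨ +-congˡ (+-+-absorbʳ _ b) ⟩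
      a ′ + (a ∙ a ′ + b)                  ≈⟨ +-assoc _ _ _ ⟨
      (a ′ + a ∙ a ′) + b                  ≈⟨ +-congʳ (a′+aa′ a) ⟩
      a ′ + b                              ∎

    a′ab : a ′ ∙ (a ∙ b) ≋ a ∙ a ′
    a′ab = begin
      a ′ ∙ (a ∙ b)      ≈⟨ ∙-congˡ (∙-congʳ (′-involutive a)) ⟨
      a ′ ∙ (a ′ ′ ∙ b)  ≈⟨ contradiction-zeroˡ (a ′) b ⟩
      a ′ ∙ a ′ ′        ≈⟨ ∙-congˡ (′-involutive a) ⟩
      a ′ ∙ a            ≈⟨ contradiction-comm a ⟨
      a ∙ a ′            ∎

  -- When `a ′ ≋ a`, duplicating `a` makes the product begin with the contradiction `a ∙ a ′`, a
  -- left zero.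
  fixpoint-zeroˡ : ∀ {a} → a ′ ≋ a → ∀ b → a ∙ b ≋ a
  fixpoint-zeroˡ {a} a′≋a b = begin
    a ∙ b          ≈⟨ ∙-∙-absorb a b ⟨
    a ∙ (a ∙ b)    ≈⟨ ∙-congˡ (∙-congʳ a′≋a) ⟨
    a ∙ (a ′ ∙ b)  ≈⟨ contradiction-zeroˡ a b ⟩
    a ∙ a ′        ≈⟨ ∙-congˡ a′≋a ⟩
    a ∙ a          ≈⟨ ∙-idem a ⟩
    a              ∎

-- The definedness term and its guards

module Laws (A : CAlgebra) where
  open CAlgebra A
  open CAlgebra (dual A) using () renaming
    ( ∙-assoc      to +-assoc
    ; ∙-distribˡ-+ to +-distribˡ-∙
    ; ∙-distribʳ-+ to +-distribʳ-∙
    ; +-absorbs-∙  to ∙-absorbs-+ )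
  open Basic A
  open Basic (dual A) using () renaming
    ( contradiction-zeroˡ to excluded-topˡ
    ; +-+-absorbʳ         to ∙-∙-absorbʳ
    ; a∙[a′+a]            to a+[a′a]
    ; a∙[a′+b]            to a+[a′b] )
  open SetoidReasoning setoid

  -- In the three-element model, d a is true when a is defined and undefined
  -- otherwise.
  d : Carrier → Carrier
  d a = a + a ′

  d-cong : ∀ {a b} → a ≋ b → d a ≋ d b
  d-cong p = +-cong p (′-cong p)

  d-′ : ∀ a → d (a ′) ≋ d a
  d-′ a = trans (+-congˡ (′-involutive a)) (sym (+-excluded-comm a))

  -- An excluded middle is true or undefined, so the rest of a disjunction is never reached; dual to
  -- `contradiction-zeroˡ`.
  d-topˡ : ∀ a b → d a + b ≋ d a
  d-topˡ a b = trans (+-assoc a (a ′) b) (excluded-topˡ a b)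

  d-d : ∀ a → d (d a) ≋ d a
  d-d a = d-topˡ a (d a ′)

  d-selfˡ : ∀ a → d a ∙ a ≋ a
  d-selfˡ a = trans ([a+b]∙a a (a ′)) (a+[a′a] a)

  d-self′ˡ : ∀ a → d a ∙ a ′ ≋ a ′
  d-self′ˡ a = trans (∙-congʳ (sym (d-′ a))) (d-selfˡ (a ′))

  d-+ˡ : ∀ a b → d a ∙ (a + b) ≋ a + b
  d-+ˡ a b = trans (sym (+-distribˡ-∙ a (a ′) b)) (a+[a′b] a b)

  -- The first operand of a disjunction is always evaluated, so its guard can stand outside. In the
  -- dual right distributive law the factor `d a + c` collapses to `d a`.
  d-∙-+ : ∀ a b c → d a ∙ b + c ≋ d a ∙ (b + c)
  d-∙-+ a b c = begin
    d a ∙ b + c                        ≈⟨ +-distribʳ-∙ (d a) b c ⟩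
    (d a + c) ∙ (d a ′ + (b + c))      ≈⟨ ∙-congʳ (d-topˡ a c) ⟩
    d a ∙ (d a ′ + (b + c))            ≈⟨ a∙[a′+b] (d a) (b + c) ⟩
    d a ∙ (b + c)                      ∎

  -- `d a ∙ d b` is never false, hence swallows whatever is added on its right; the commutativity
  -- axiom then equates the two orders.
  d-comm : ∀ a b → d a ∙ d b ≋ d b ∙ d a
  d-comm a b = begin
    d a ∙ d b                    ≈⟨ left a b (d b ∙ d a) ⟨
    d a ∙ d b + d b ∙ d a        ≈⟨ ∙+-comm (d a) (d b) ⟩
    d b ∙ d a + d a ∙ d b        ≈⟨ left b a (d a ∙ d b) ⟩
    d b ∙ d a                    ∎
    where
    left : ∀ a b c → d a ∙ d b + c ≋ d a ∙ d b
    left a b c = trans (d-∙-+ a (d b) c) (∙-congˡ (d-topˡ b c))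

  -- The factor `a ′ + d b` reflects short-circuiting: once `a` is defined, `b` has to be defined
  -- only if `a` is true.
  d-∙ : ∀ a b → d (a ∙ b) ≋ d a ∙ (a ′ + d b)
  d-∙ a b = begin
    a ∙ b + (a ∙ b) ′                                ≈⟨ +-congˡ (′-∙ a b) ⟩
    a ∙ b + (a ′ + b ′)                              ≈⟨ +-distribʳ-∙ a b _ ⟩
    (a + (a ′ + b ′)) ∙ (a ′ + (b + (a ′ + b ′)))    ≈⟨ ∙-cong (excluded-topˡ a _) lemma ⟩
    d a ∙ (a ′ + d b)                                ∎
    where
    lemma : a ′ + (b + (a ′ + b ′)) ≋ a ′ + d b
    lemma = begin
      a ′ + (b + (a ′ + b ′))  ≈⟨ +-congˡ (+-assoc b (a ′) (b ′)) ⟨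
      a ′ + ((b + a ′) + b ′)  ≈⟨ +-assoc _ _ _ ⟨
      (a ′ + (b + a ′)) + b ′  ≈⟨ +-congʳ (+-+-absorbʳ (a ′) b) ⟩
      (a ′ + b) + b ′          ≈⟨ +-assoc _ _ _ ⟩
      a ′ + d b                ∎

  d-[d∙] : ∀ a b → d (d a ∙ b) ≋ d a ∙ d b
  d-[d∙] a b = begin
    d (d a ∙ b)                  ≈⟨ d-∙ (d a) b ⟩
    d (d a) ∙ (d a ′ + d b)      ≈⟨ ∙-congʳ (d-d a) ⟩
    d a ∙ (d a ′ + d b)          ≈⟨ a∙[a′+b] (d a) (d b) ⟩
    d a ∙ d b                    ∎

  ∙-sandwich : ∀ a b c → a ∙ (b ∙ (a ∙ c)) ≋ a ∙ (b ∙ c)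
  ∙-sandwich a b c = begin
    a ∙ (b ∙ (a ∙ c))  ≈⟨ ∙-congˡ (∙-assoc b a c) ⟨
    a ∙ ((b ∙ a) ∙ c)  ≈⟨ ∙-assoc a (b ∙ a) c ⟨
    (a ∙ (b ∙ a)) ∙ c  ≈⟨ ∙-congʳ (∙-∙-absorbʳ a b) ⟩
    (a ∙ b) ∙ c        ≈⟨ ∙-assoc a b c ⟩
    a ∙ (b ∙ c)        ∎

  ∙-sandwich₂ : ∀ a b c e → a ∙ (b ∙ (c ∙ (a ∙ e))) ≋ a ∙ (b ∙ (c ∙ e))
  ∙-sandwich₂ a b c e = begin
    a ∙ (b ∙ (c ∙ (a ∙ e)))  ≈⟨ ∙-congˡ (∙-assoc b c _) ⟨
    a ∙ ((b ∙ c) ∙ (a ∙ e))  ≈⟨ ∙-sandwich a (b ∙ c) e ⟩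
    a ∙ ((b ∙ c) ∙ e)        ≈⟨ ∙-congˡ (∙-assoc b c e) ⟩
    a ∙ (b ∙ (c ∙ e))        ∎

  ∙-sandwich-+ : ∀ a b c e → a ∙ (b ∙ (c + a ∙ e)) ≋ a ∙ (b ∙ (c + e))
  ∙-sandwich-+ a b c e = begin
    a ∙ (b ∙ (c + a ∙ e))                    ≈⟨ expand c (a ∙ e) ⟩
    a ∙ (b ∙ c) + a ∙ (b ∙ (a ∙ e))          ≈⟨ +-congˡ (∙-sandwich a b e) ⟩
    a ∙ (b ∙ c) + a ∙ (b ∙ e)                ≈⟨ expand c e ⟨
    a ∙ (b ∙ (c + e))                        ∎
    where
    expand : ∀ c e → a ∙ (b ∙ (c + e)) ≋ a ∙ (b ∙ c) + a ∙ (b ∙ e)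
    expand c e = trans (∙-congˡ (∙-distribˡ-+ b c e)) (∙-distribˡ-+ a _ _)

  -- `a ∙ a ′` is false when `a` is defined, so it acts only as a check of `a` before `b`.
  contradiction-+ : ∀ a b → a ∙ a ′ + b ≋ d a ∙ b
  contradiction-+ a b = begin
    a ∙ a ′ + b                                  ≈⟨ +-distribʳ-∙ a (a ′) b ⟩
    (a + b) ∙ (a ′ + (a ′ + b))                  ≈⟨ ∙-congˡ (+-+-absorb (a ′) b) ⟩
    (a + b) ∙ (a ′ + b)                          ≈⟨ ∙-distribʳ-+ a b (a ′ + b) ⟩
    a ∙ (a ′ + b) + a ′ ∙ (b ∙ (a ′ + b))        ≈⟨ +-cong (a∙[a′+b] a b) lemma ⟩
    a ∙ b + a ′ ∙ b                              ≈⟨ ∙-excluded-expand a b ⟨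
    d a ∙ b                                      ∎
    where
    lemma : a ′ ∙ (b ∙ (a ′ + b)) ≋ a ′ ∙ b
    lemma = begin
      -- Absorption inserts a copy of `a ′ + b` before `b`, which makes the later copy removable by
      -- left regularity.
      a ′ ∙ (b ∙ (a ′ + b))                      ≈⟨ ∙-congʳ (∙-absorbs-+ (a ′) b) ⟨
      (a ′ ∙ (a ′ + b)) ∙ (b ∙ (a ′ + b))        ≈⟨ ∙-assoc _ _ _ ⟩
      a ′ ∙ ((a ′ + b) ∙ (b ∙ (a ′ + b)))        ≈⟨ ∙-congˡ (∙-∙-absorbʳ (a ′ + b) b) ⟩
      a ′ ∙ ((a ′ + b) ∙ b)                      ≈⟨ ∙-assoc _ _ _ ⟨
      (a ′ ∙ (a ′ + b)) ∙ b                      ≈⟨ ∙-congʳ (∙-absorbs-+ (a ′) b) ⟩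
      a ′ ∙ b                                    ∎

  -- Distributing over the right factor leaves `d a ∙ b` and `a + b ∙ a`; the guard moves out and
  -- `a+[b+ab]` deletes `b ∙ a`. This law and its dual yield the definedness formulas of the full
  -- connectives.
  [a+b]∙[b+a] : ∀ a b → (a + b) ∙ (b + a) ≋ d a ∙ (b + a)
  [a+b]∙[b+a] a b = begin
    (a + b) ∙ (b + a)                ≈⟨ ∙-distribˡ-+ (a + b) b a ⟩
    (a + b) ∙ b + (a + b) ∙ a        ≈⟨ +-cong lemma ([a+b]∙a a b) ⟩
    d a ∙ b + (a + b ∙ a)            ≈⟨ d-∙-+ a b (a + b ∙ a) ⟩
    d a ∙ (b + (a + b ∙ a))          ≈⟨ ∙-congˡ (a+[b+ab] b a) ⟩
    d a ∙ (b + a)                    ∎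
    where
    lemma : (a + b) ∙ b ≋ d a ∙ b
    lemma = begin
      (a + b) ∙ b              ≈⟨ ∙-distribʳ-+ a b b ⟩
      a ∙ b + a ′ ∙ (b ∙ b)    ≈⟨ +-congˡ (∙-congˡ (∙-idem b)) ⟩
      a ∙ b + a ′ ∙ b          ≈⟨ ∙-excluded-expand a b ⟨
      d a ∙ b                  ∎

-- Full connectives in a C-algebra

module Full (A : CAlgebra) where
  open CAlgebra A
  open CAlgebra (dual A) using () renaming (′-∙ to ′-+; ∙+-comm to +∙-comm)
  open Basic A
  open Laws A
  open SetoidReasoning setoid

  infixr 6 _⊞_
  infixr 7 _⊡_

  _⊡_ _⊞_ : Carrier → Carrier → Carrier
  a ⊡ b = a ∙ b + b ∙ a
  a ⊞ b = (a ′ ⊡ b ′) ′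

  ⊡-comm : ∀ a b → a ⊡ b ≋ b ⊡ a
  ⊡-comm = ∙+-comm

  ⊡-cong : ∀ {a b c e} → a ≋ b → c ≋ e → a ⊡ c ≋ b ⊡ e
  ⊡-cong p q = +-cong (∙-cong p q) (∙-cong q p)

  -- `a ∙ b` skips `b` when `a` is false; the guard `d b` restores its evaluation. The dual of
  -- `[a+b]∙[b+a]` puts the contradiction `b ∙ b ′` in front, which is that guard by
  -- `contradiction-+`.
  ⊡-definedness : ∀ a b → a ⊡ b ≋ d b ∙ (a ∙ b)
  ⊡-definedness a b = begin
    a ∙ b + b ∙ a      ≈⟨ ∙+-comm a b ⟩
    b ∙ a + a ∙ b      ≈⟨ Laws.[a+b]∙[b+a] (dual A) b a ⟩
    b ∙ b ′ + a ∙ b    ≈⟨ contradiction-+ b (a ∙ b) ⟩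
    d b ∙ (a ∙ b)      ∎

  ⊞-definedness : ∀ a b → a ⊞ b ≋ d b ∙ (a + b)
  ⊞-definedness a b = begin
    (a ′ ∙ b ′ + b ′ ∙ a ′) ′          ≈⟨ ′-cong (+-cong (′-+ a b) (′-+ b a)) ⟨
    ((a + b) ′ + (b + a) ′) ′          ≈⟨ ′-cong (′-∙ _ _) ⟨
    ((a + b) ∙ (b + a)) ′ ′            ≈⟨ ′-involutive _ ⟩
    (a + b) ∙ (b + a)                  ≈⟨ +∙-comm a b ⟩
    (b + a) ∙ (a + b)                  ≈⟨ [a+b]∙[b+a] b a ⟩
    d b ∙ (a + b)                      ∎

  d-⊡ : ∀ a b → d (a ⊡ b) ≋ d b ∙ d a
  d-⊡ a b = begin
    d (a ⊡ b)                            ≈⟨ d-cong (⊡-definedness a b) ⟩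
    d (d b ∙ (a ∙ b))                    ≈⟨ d-[d∙] b (a ∙ b) ⟩
    d b ∙ d (a ∙ b)                      ≈⟨ ∙-congˡ (d-∙ a b) ⟩
    d b ∙ (d a ∙ (a ′ + d b))            ≈⟨ ∙-congˡ (∙-distribˡ-+ (d a) _ _) ⟩
    d b ∙ (d a ∙ a ′ + d a ∙ d b)        ≈⟨ ∙-congˡ (+-cong (d-self′ˡ a) (d-comm a b)) ⟩
    -- With `d b` in front the inner `d b` is idle, leaving `a ′ + d a`, which is `d a`.
    d b ∙ (a ′ + d b ∙ d a)              ≈⟨ ∙-distribˡ-+ (d b) _ _ ⟩
    d b ∙ a ′ + d b ∙ (d b ∙ d a)        ≈⟨ +-congˡ (∙-∙-absorb (d b) (d a)) ⟩
    d b ∙ a ′ + d b ∙ d a                ≈⟨ ∙-distribˡ-+ (d b) _ _ ⟨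
    d b ∙ (a ′ + (a + a ′))              ≈⟨ ∙-congˡ (+-+-absorbʳ (a ′) a) ⟩
    d b ∙ (a ′ + a)                      ≈⟨ ∙-congˡ (+-excluded-comm a) ⟨
    d b ∙ d a                            ∎

  d-⊞ : ∀ a b → d (a ⊞ b) ≋ d b ∙ d a
  d-⊞ a b = begin
    d (a ⊞ b)             ≈⟨ d-′ (a ′ ⊡ b ′) ⟩
    d (a ′ ⊡ b ′)         ≈⟨ d-⊡ (a ′) (b ′) ⟩
    d (b ′) ∙ d (a ′)     ≈⟨ ∙-cong (d-′ b) (d-′ a) ⟩
    d b ∙ d a             ∎

  ′-⊡ : ∀ a b → (a ⊡ b) ′ ≋ a ′ ⊞ b ′
  ′-⊡ a b = ′-cong (⊡-cong (sym (′-involutive a)) (sym (′-involutive b)))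

  -- Both sides reduce to `d c ∙ (d b ∙ (a ∙ (b ∙ c)))`; the right side carries a second `d c`,
  -- deleted as a repeated guard.
  ⊡-assoc : ∀ a b c → (a ⊡ b) ⊡ c ≋ a ⊡ (b ⊡ c)
  ⊡-assoc a b c = begin
    (a ⊡ b) ⊡ c                            ≈⟨ ⊡-definedness (a ⊡ b) c ⟩
    d c ∙ ((a ⊡ b) ∙ c)                    ≈⟨ ∙-congˡ (∙-congʳ (⊡-definedness a b)) ⟩
    d c ∙ ((d b ∙ (a ∙ b)) ∙ c)            ≈⟨ ∙-congˡ (∙-assoc _ _ _) ⟩
    d c ∙ (d b ∙ ((a ∙ b) ∙ c))            ≈⟨ ∙-congˡ (∙-congˡ (∙-assoc a b c)) ⟩
    d c ∙ (d b ∙ (a ∙ (b ∙ c)))            ≈⟨ ∙-sandwich₂ _ _ _ _ ⟨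
    d c ∙ (d b ∙ (a ∙ (d c ∙ (b ∙ c))))    ≈⟨ ∙-assoc _ _ _ ⟨
    (d c ∙ d b) ∙ (a ∙ (d c ∙ (b ∙ c)))    ≈⟨ ∙-cong (d-⊡ b c) (∙-congˡ (⊡-definedness b c)) ⟨
    d (b ⊡ c) ∙ (a ∙ (b ⊡ c))              ≈⟨ ⊡-definedness a (b ⊡ c) ⟨
    a ⊡ (b ⊡ c)                            ∎

  ⊞-[′⊡] : ∀ a b → a ⊞ (a ′ ⊡ b) ≋ a ⊞ b
  ⊞-[′⊡] a b = begin
    a ⊞ (a ′ ⊡ b)                              ≈⟨ ⊞-definedness a (a ′ ⊡ b) ⟩
    d (a ′ ⊡ b) ∙ (a + a ′ ⊡ b)                ≈⟨ ∙-cong (d-⊡ (a ′) b) (+-congˡ (⊡-definedness (a ′) b)) ⟩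
    (d b ∙ d (a ′)) ∙ (a + d b ∙ (a ′ ∙ b))    ≈⟨ ∙-congʳ (∙-congˡ (d-′ a)) ⟩
    (d b ∙ d a) ∙ (a + d b ∙ (a ′ ∙ b))        ≈⟨ ∙-assoc _ _ _ ⟩
    d b ∙ (d a ∙ (a + d b ∙ (a ′ ∙ b)))        ≈⟨ ∙-sandwich-+ _ _ _ _ ⟩
    d b ∙ (d a ∙ (a + a ′ ∙ b))                ≈⟨ ∙-congˡ (∙-congˡ (a+[a′b] a b)) ⟩
    d b ∙ (d a ∙ (a + b))                      ≈⟨ ∙-congˡ (d-+ˡ a b) ⟩
    d b ∙ (a + b)                              ≈⟨ ⊞-definedness a b ⟨
    a ⊞ b                                      ∎
    where open Basic (dual A) using () renaming (a∙[a′+b] to a+[a′b])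

  -- Both sides reduce to `a ∙ (b + c)` behind the guards `d c` and `d b`.
  ⊡-distribˡ-⊞ : ∀ a b c → a ⊡ (b ⊞ c) ≋ (a ⊡ b) ⊞ (a ⊡ c)
  ⊡-distribˡ-⊞ a b c = begin
    a ⊡ (b ⊞ c)                                              ≈⟨ ⊡-definedness a (b ⊞ c) ⟩
    d (b ⊞ c) ∙ (a ∙ (b ⊞ c))                                ≈⟨ ∙-cong (d-⊞ b c) (∙-congˡ (⊞-definedness b c)) ⟩
    (d c ∙ d b) ∙ (a ∙ (d c ∙ (b + c)))                      ≈⟨ ∙-assoc _ _ _ ⟩
    d c ∙ (d b ∙ (a ∙ (d c ∙ (b + c))))                      ≈⟨ ∙-sandwich₂ _ _ _ _ ⟩
    -- The right side has the additional guard `d a`, which is idle before a factor `a`.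
    d c ∙ (d b ∙ (a ∙ (b + c)))                              ≈⟨ ∙-congˡ (∙-congˡ lemma) ⟨
    d c ∙ (d b ∙ (d a ∙ (a ∙ b + a ∙ c)))                    ≈⟨ ∙-congˡ (∙-assoc _ _ _) ⟨
    d c ∙ ((d b ∙ d a) ∙ (a ∙ b + a ∙ c))                    ≈⟨ ∙-congˡ (∙-congʳ (d-comm b a)) ⟩
    d c ∙ ((d a ∙ d b) ∙ (a ∙ b + a ∙ c))                    ≈⟨ ∙-sandwich-+ _ _ _ _ ⟨
    d c ∙ ((d a ∙ d b) ∙ (a ∙ b + d c ∙ (a ∙ c)))            ≈⟨ ∙-congˡ (∙-assoc _ _ _) ⟩
    d c ∙ (d a ∙ (d b ∙ (a ∙ b + d c ∙ (a ∙ c))))            ≈⟨ ∙-congˡ (∙-congˡ (d-∙-+ b _ _)) ⟨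
    d c ∙ (d a ∙ (d b ∙ (a ∙ b) + d c ∙ (a ∙ c)))            ≈⟨ ∙-assoc _ _ _ ⟨
    (d c ∙ d a) ∙ (d b ∙ (a ∙ b) + d c ∙ (a ∙ c))            ≈⟨ ∙-cong (d-⊡ a c) (+-cong (⊡-definedness a b) (⊡-definedness a c)) ⟨
    d (a ⊡ c) ∙ (a ⊡ b + a ⊡ c)                              ≈⟨ ⊞-definedness (a ⊡ b) (a ⊡ c) ⟨
    (a ⊡ b) ⊞ (a ⊡ c)                                        ∎
    where
    lemma : d a ∙ (a ∙ b + a ∙ c) ≋ a ∙ (b + c)
    lemma = begin
      d a ∙ (a ∙ b + a ∙ c)    ≈⟨ ∙-congˡ (∙-distribˡ-+ a b c) ⟨
      d a ∙ (a ∙ (b + c))      ≈⟨ ∙-assoc _ _ _ ⟨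
      (d a ∙ a) ∙ (b + c)      ≈⟨ ∙-congʳ (d-selfˡ a) ⟩
      a ∙ (b + c)              ∎

-- Derivability

⊢-isEquivalence : ∀ {C B} {Th : Theory C B} →
  IsEquivalence (λ s r → Th ⊢ s ≈ r)
⊢-isEquivalence = record { refl = ≈-refl ; sym = ≈-sym ; trans = ≈-trans }

-- The axioms use only `x`, `y` and `z`, so the value at indices above 2 is filler; for axioms in
-- fewer variables an entry is repeated.
⟨_,_,_⟩ : ∀ {C B} → Term C B → Term C B → Term C B → ℕ → Term C B
⟨ a , b , c ⟩ zero          = a
⟨ a , b , c ⟩ (suc zero)    = b
⟨ a , b , c ⟩ (suc (suc _)) = c

-- The Lindenbaum algebra of a theory containing `CL`, with derivability as equality: the laws of
-- C-algebras become derivations.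
termAlgebra : ∀ {C B} ⦃ _ : Sequential ⊑ B ⦄ {Th : Theory C B} →
  (∀ {e} → CL e → Th e) → CAlgebra
termAlgebra {Th = Th} CL⊆Th = record
  { _≋_ = λ s r → Th ⊢ s ≈ r ; _′ = ¬_ ; _∙_ = _∧_ ; _+_ = _∨_
  ; isEquivalence = ⊢-isEquivalence
  ; ′-cong = ¬-cong ; ∙-cong = bin-cong _ ; +-cong = bin-cong _
  ; ′-involutive = λ a → instanceOf (axiom (CL⊆Th involution)) ⟨ a , a , a ⟩
  ; ′-∙ = λ a b → instanceOf (axiom (CL⊆Th deMorgan)) ⟨ a , b , b ⟩
  ; ∙-assoc = λ a b c → instanceOf (axiom (CL⊆Th ∧-assoc)) ⟨ a , b , c ⟩
  ; ∙-distribˡ-+ = λ a b c → instanceOf (axiom (CL⊆Th ∧-distribˡ)) ⟨ a , b , c ⟩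
  ; ∙-distribʳ-+ = λ a b c → instanceOf (axiom (CL⊆Th ∧-distribʳ)) ⟨ a , b , c ⟩
  ; +-absorbs-∙ = λ a b → instanceOf (axiom (CL⊆Th ∨-absorbs-∧)) ⟨ a , b , b ⟩
  ; ∙+-comm = λ a b → instanceOf (axiom (CL⊆Th ∧∨-comm)) ⟨ a , b , b ⟩
  }

-- Strict equations derived in extensions of `CL`

module FullCL {C : Set} {Th : Theory C AllConnectives}
              (CL⊆Th : ∀ {e} → CL e → Th e) where

  algebra : CAlgebra
  algebra = termAlgebra {Th = Th ⟨∧•,∨•⟩} (λ ax → base (CL⊆Th ax))

  open Full algebra

  infix 3 _⊢•_
  _⊢•_ : Term C AllConnectives → Term C AllConnectives → Set
  s ⊢• r = (Th ⟨∧•,∨•⟩) ⊢ s ≈ r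

  -- Arguments are translated together with the connective, so that nested full connectives unfold
  -- by nested applications.
  ∧•≈⊡ : ∀ {a b c e} → a ⊢• c → b ⊢• e → a ∧• b ⊢• c ⊡ e
  ∧•≈⊡ {a} {b} p q = ≈-trans (instanceOf (axiom ∧•-def) ⟨ a , b , b ⟩) (⊡-cong p q)

  ∨•≈⊞ : ∀ {a b c e} → a ⊢• c → b ⊢• e → a ∨• b ⊢• c ⊞ e
  ∨•≈⊞ {a} {b} p q = ≈-trans (instanceOf (axiom ∨•-def) ⟨ a , b , b ⟩)
    (¬-cong (∧•≈⊡ (¬-cong p) (¬-cong q)))

  via : ∀ {a b c e} → a ⊢• c → c ⊢• e → b ⊢• e → a ⊢• b
  via p q r = ≈-trans p (≈-trans q (≈-sym r))

  S3-derivable : (Th ⟨∧•,∨•⟩) ⊢ S3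
  S3-derivable = axiom (base (CL⊆Th involution))

  S4-derivable : (Th ⟨∧•,∨•⟩) ⊢ S4
  S4-derivable = via (¬-cong (∧•≈⊡ ≈-refl ≈-refl)) (′-⊡ _ _) (∨•≈⊞ ≈-refl ≈-refl)

  S6-derivable : (Th ⟨∧•,∨•⟩) ⊢ S6
  S6-derivable = via (∧•≈⊡ (∧•≈⊡ ≈-refl ≈-refl) ≈-refl) (⊡-assoc _ _ _)
    (∧•≈⊡ ≈-refl (∧•≈⊡ ≈-refl ≈-refl))

  S8-derivable : (Th ⟨∧•,∨•⟩) ⊢ S8
  S8-derivable = via (∨•≈⊞ ≈-refl (∧•≈⊡ ≈-refl ≈-refl)) (⊞-[′⊡] _ _)
    (∨•≈⊞ ≈-refl ≈-refl)

  S9-derivable : (Th ⟨∧•,∨•⟩) ⊢ S9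
  S9-derivable = via (∧•≈⊡ ≈-refl ≈-refl) (⊡-comm _ _) (∧•≈⊡ ≈-refl ≈-refl)

  S10-derivable : (Th ⟨∧•,∨•⟩) ⊢ S10
  S10-derivable = via (∧•≈⊡ ≈-refl (∨•≈⊞ ≈-refl ≈-refl)) (⊡-distribˡ-⊞ _ _ _)
    (∨•≈⊞ (∧•≈⊡ ≈-refl ≈-refl) (∧•≈⊡ ≈-refl ≈-refl))

module FullCL₂ {C : Set} ⦃ _ : Const₂ ⊑ C ⦄ {Th : Theory C AllConnectives}
               (CL₂⊆Th : ∀ {e} → CL₂ e → Th e) where

  open FullCL {Th = Th} (λ ax → CL₂⊆Th (CL₂.cl ax))
  open CAlgebra algebra using (+-congʳ; +-absorbs-∙)

  S1-derivable : (Th ⟨∧•,∨•⟩) ⊢ S1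
  S1-derivable = axiom (base (CL₂⊆Th ¬T))

  -- In `(T ∧ x) ∨ (x ∧ T)` the first disjunct is `x`, which absorbs the second.
  S7-derivable : (Th ⟨∧•,∨•⟩) ⊢ S7
  S7-derivable = ≈-trans (∧•≈⊡ ≈-refl ≈-refl)
    (≈-trans (+-congʳ (axiom (base (CL₂⊆Th ∧-identityˡ)))) (+-absorbs-∙ x T))

module FullCL₃ where

  open FullCL {Th = CL₃} (λ ax → cl₂ (CL₂.cl ax))
  open CAlgebra algebra using (+-congʳ)

  S2-derivable : CL₃⟨∧•,∨•⟩ ⊢ S2
  S2-derivable = axiom (base ¬U)

  -- `U` is a fixpoint of negation, hence a left zero of `∧` and, dually, of `∨`; so
  -- `(U ∧ x) ∨ (x ∧ U)` collapses in two steps.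
  S11-derivable : CL₃⟨∧•,∨•⟩ ⊢ S11
  S11-derivable = ≈-trans (∧•≈⊡ ≈-refl ≈-refl)
    (≈-trans (+-congʳ (Basic.fixpoint-zeroˡ algebra S2-derivable x))
      (Basic.fixpoint-zeroˡ (dual algebra) S2-derivable (x ∧ U)))

-- Bochvar's logic: soundness

⟦⟧-[] : ∀ s σ ρ → ⟦ s [ σ ] ⟧ ρ ≡ ⟦ s ⟧ (λ i → ⟦ σ i ⟧ ρ)
⟦⟧-[] (var i)        σ ρ = ≡.refl
⟦⟧-[] (con t)        σ ρ = ≡.refl
⟦⟧-[] (con f)        σ ρ = ≡.refl
⟦⟧-[] (con u)        σ ρ = ≡.refl
⟦⟧-[] (¬ s)          σ ρ = ≡.cong (Maybe.map not) (⟦⟧-[] s σ ρ)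
⟦⟧-[] (bin and• s r) σ ρ = ≡.cong₂ (zipWith Bool._∧_) (⟦⟧-[] s σ ρ) (⟦⟧-[] r σ ρ)
⟦⟧-[] (bin or• s r)  σ ρ = ≡.cong₂ (zipWith Bool._∨_) (⟦⟧-[] s σ ρ) (⟦⟧-[] r σ ρ)

axioms-valid : ∀ {e} → StrictAxioms e → BochvarValid e
axioms-valid s1 ρ = ≡.refl
axioms-valid s2 ρ = ≡.refl
axioms-valid s3 ρ with ρ 0
... | nothing = ≡.refl
... | just a  = ≡.cong just (Bool.not-involutive a)
axioms-valid s4 ρ with ρ 0 | ρ 1
... | nothing    | _       = ≡.refl
... | just _     | nothing = ≡.refl
... | just true  | just _  = ≡.refl
... | just false | just _  = ≡.refl
axioms-valid s6 ρ with ρ 0 | ρ 1 | ρ 2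
... | nothing | _       | _       = ≡.refl
... | just _  | nothing | _       = ≡.refl
... | just _  | just _  | nothing = ≡.refl
... | just a  | just b  | just c  = ≡.cong just (Bool.∧-assoc a b c)
axioms-valid s7 ρ with ρ 0
... | nothing = ≡.refl
... | just _  = ≡.refl
axioms-valid s8 ρ with ρ 0 | ρ 1
... | nothing    | _       = ≡.refl
... | just _     | nothing = ≡.refl
... | just true  | just _  = ≡.refl
... | just false | just _  = ≡.refl
axioms-valid s9 ρ with ρ 0 | ρ 1
... | nothing | nothing = ≡.refl
... | nothing | just _  = ≡.refl
... | just _  | nothing = ≡.refl
... | just a  | just b  = ≡.cong just (Bool.∧-comm a b)
axioms-valid s10 ρ with ρ 0 | ρ 1 | ρ 2
... | nothing | _       | _       = ≡.refl
... | just _  | nothing | _       = ≡.refl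
... | just _  | just _  | nothing = ≡.refl
... | just a  | just b  | just c  = ≡.cong just (Bool.∧-distribˡ-∨ a b c)
axioms-valid s11 ρ = ≡.refl

sound : ∀ {e} → StrictAxioms ⊢ e → BochvarValid e
sound (axiom ax)         ρ = axioms-valid ax ρ
sound ≈-refl             ρ = ≡.refl
sound (≈-sym p)          ρ = ≡.sym (sound p ρ)
sound (≈-trans p q)      ρ = ≡.trans (sound p ρ) (sound q ρ)
sound (¬-cong p)         ρ = ≡.cong (Maybe.map not) (sound p ρ)
sound (bin-cong and• p q) ρ = ≡.cong₂ (zipWith Bool._∧_) (sound p ρ) (sound q ρ)
sound (bin-cong or• p q) ρ = ≡.cong₂ (zipWith Bool._∨_) (sound p ρ) (sound q ρ)
sound (instanceOf {s} {r} p σ) ρ =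
  ≡.trans (⟦⟧-[] s σ ρ) (≡.trans (sound p _) (≡.sym (⟦⟧-[] r σ ρ)))

-- Bochvar's logic: completeness

StrictTerm : Set
StrictTerm = Term Const₃ FullSequential

infix 3 _≃_
_≃_ : StrictTerm → StrictTerm → Set
s ≃ r = StrictAxioms ⊢ s ≈ r

strictSetoid : Setoid _ _
strictSetoid = record { Carrier = StrictTerm ; _≈_ = _≃_ ; isEquivalence = ⊢-isEquivalence }

open SetoidReasoning strictSetoid

∧•-congˡ : ∀ {a b c} → b ≃ c → a ∧• b ≃ a ∧• c
∧•-congˡ = bin-cong and• ≈-refl

∧•-congʳ : ∀ {a b c} → b ≃ c → b ∧• a ≃ c ∧• a
∧•-congʳ p = bin-cong and• p ≈-refl

∨•-cong : ∀ {a b c e} → a ≃ b → c ≃ e → a ∨• c ≃ b ∨• e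
∨•-cong = bin-cong or•

¬-involutive : ∀ a → ¬ ¬ a ≃ a
¬-involutive a = instanceOf (axiom s3) ⟨ a , a , a ⟩

¬-injective : ∀ {a b} → ¬ a ≃ ¬ b → a ≃ b
¬-injective p = ≈-trans (≈-sym (¬-involutive _)) (≈-trans (¬-cong p) (¬-involutive _))

¬-∧• : ∀ a b → ¬ (a ∧• b) ≃ ¬ a ∨• ¬ b
¬-∧• a b = instanceOf (axiom s4) ⟨ a , b , b ⟩

∧•-assoc : ∀ a b c → (a ∧• b) ∧• c ≃ a ∧• (b ∧• c)
∧•-assoc a b c = instanceOf (axiom s6) ⟨ a , b , c ⟩

∧•-identityˡ : ∀ a → T ∧• a ≃ a
∧•-identityˡ a = instanceOf (axiom s7) ⟨ a , a , a ⟩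

∨•-[¬∧•] : ∀ a b → a ∨• (¬ a ∧• b) ≃ a ∨• b
∨•-[¬∧•] a b = instanceOf (axiom s8) ⟨ a , b , b ⟩

∧•-comm : ∀ a b → a ∧• b ≃ b ∧• a
∧•-comm a b = instanceOf (axiom s9) ⟨ a , b , b ⟩

∧•-distribˡ : ∀ a b c → a ∧• (b ∨• c) ≃ (a ∧• b) ∨• (a ∧• c)
∧•-distribˡ a b c = instanceOf (axiom s10) ⟨ a , b , c ⟩

∧•-zeroˡ : ∀ a → U ∧• a ≃ U
∧•-zeroˡ a = instanceOf (axiom s11) ⟨ a , a , a ⟩

∧•-identityʳ : ∀ a → a ∧• T ≃ a
∧•-identityʳ a = ≈-trans (∧•-comm a T) (∧•-identityˡ a)

∧•-leftComm : ∀ a b c → a ∧• (b ∧• c) ≃ b ∧• (a ∧• c)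
∧•-leftComm a b c = ≈-trans (≈-sym (∧•-assoc a b c))
  (≈-trans (∧•-congʳ (∧•-comm a b)) (∧•-assoc b a c))

¬F≃T : ¬ F ≃ T
¬F≃T = ≈-trans (¬-cong (≈-sym (axiom s1))) (¬-involutive T)

∨•-deMorgan : ∀ a b → a ∨• b ≃ ¬ (¬ a ∧• ¬ b)
∨•-deMorgan a b = ≈-sym (≈-trans (¬-∧• (¬ a) (¬ b))
  (∨•-cong (¬-involutive a) (¬-involutive b)))

¬-∨• : ∀ a b → ¬ (a ∨• b) ≃ ¬ a ∧• ¬ b
¬-∨• a b = ≈-trans (¬-cong (∨•-deMorgan a b)) (¬-involutive _)

∨•-comm : ∀ a b → a ∨• b ≃ b ∨• a
∨•-comm a b = ¬-injective
  (≈-trans (¬-∨• a b) (≈-trans (∧•-comm _ _) (≈-sym (¬-∨• b a))))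

∨•-identityʳ : ∀ a → a ∨• F ≃ a
∨•-identityʳ a = ¬-injective
  (≈-trans (¬-∨• a F) (≈-trans (∧•-congˡ ¬F≃T) (∧•-identityʳ _)))

∧•-[¬∨•] : ∀ a b → a ∧• (¬ a ∨• b) ≃ a ∧• b
∧•-[¬∨•] a b = ¬-injective (begin
  ¬ (a ∧• (¬ a ∨• b))         ≈⟨ ¬-∧• _ _ ⟩
  ¬ a ∨• ¬ (¬ a ∨• b)         ≈⟨ ∨•-cong ≈-refl (¬-∨• _ _) ⟩
  ¬ a ∨• (¬ ¬ a ∧• ¬ b)       ≈⟨ ∨•-[¬∧•] (¬ a) (¬ b) ⟩
  ¬ a ∨• ¬ b                  ≈⟨ ¬-∧• a b ⟨
  ¬ (a ∧• b)                  ∎)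

-- Strictness keeps a disjunction with `T` from being `T`; `S8` at `T` makes it an excluded middle
-- instead.
¬∨•T : ∀ a → ¬ a ∨• T ≃ ¬ a ∨• a
¬∨•T a = begin
  ¬ a ∨• T               ≈⟨ ∨•-[¬∧•] (¬ a) T ⟨
  ¬ a ∨• (¬ ¬ a ∧• T)    ≈⟨ ∨•-cong ≈-refl (∧•-identityʳ _) ⟩
  ¬ a ∨• ¬ ¬ a           ≈⟨ ∨•-cong ≈-refl (¬-involutive a) ⟩
  ¬ a ∨• a               ∎

∧•-idem : ∀ a → a ∧• a ≃ a
∧•-idem a = begin
  a ∧• a               ≈⟨ ∧•-[¬∨•] a a ⟨
  a ∧• (¬ a ∨• a)      ≈⟨ ∧•-congˡ (¬∨•T a) ⟨
  a ∧• (¬ a ∨• T)      ≈⟨ ∧•-[¬∨•] a T ⟩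
  a ∧• T               ≈⟨ ∧•-identityʳ a ⟩
  a                    ∎

∨•-idem : ∀ a → a ∨• a ≃ a
∨•-idem a = ¬-injective (≈-trans (¬-∨• a a) (∧•-idem (¬ a)))

-- The dual of `S8` with `F` as second disjunct, after writing `a` as `¬ ¬ a ∨• F`.
¬∧•-self : ∀ a → ¬ a ∧• a ≃ ¬ a ∧• F
¬∧•-self a = begin
  ¬ a ∧• a                 ≈⟨ ∧•-congˡ (∨•-identityʳ a) ⟨
  ¬ a ∧• (a ∨• F)          ≈⟨ ∧•-congˡ (∨•-cong (¬-involutive a) ≈-refl) ⟨
  ¬ a ∧• (¬ ¬ a ∨• F)      ≈⟨ ∧•-[¬∨•] (¬ a) F ⟩
  ¬ a ∧• F                 ∎

-- The contradiction of `a` is symmetric in `a` and `¬ a`, and `¬∧•-self` evaluates it in either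
-- order.
¬∧•F : ∀ a → ¬ a ∧• F ≃ a ∧• F
¬∧•F a = begin
  ¬ a ∧• F        ≈⟨ ¬∧•-self a ⟨
  ¬ a ∧• a        ≈⟨ ∧•-congˡ (¬-involutive a) ⟨
  ¬ a ∧• ¬ ¬ a    ≈⟨ ∧•-comm _ _ ⟩
  ¬ ¬ a ∧• ¬ a    ≈⟨ ¬∧•-self (¬ a) ⟩
  ¬ ¬ a ∧• F      ≈⟨ ∧•-congʳ (¬-involutive a) ⟩
  a ∧• F          ∎

-- Evaluation under conjunctions of literals

constant : Value → StrictTerm
constant (just true)  = T
constant (just false) = F
constant nothing      = U

constant-¬ : ∀ v → ¬ constant v ≃ constant (Maybe.map not v)
constant-¬ (just true)  = axiom s1
constant-¬ (just false) = ¬F≃T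
constant-¬ nothing      = axiom s2

constant-∧• : ∀ v w → constant v ∧• constant w ≃ constant (zipWith Bool._∧_ v w)
constant-∧• nothing      w            = ∧•-zeroˡ _
constant-∧• (just true)  nothing      = ∧•-identityˡ U
constant-∧• (just true)  (just true)  = ∧•-identityˡ T
constant-∧• (just true)  (just false) = ∧•-identityˡ F
constant-∧• (just false) nothing      = ≈-trans (∧•-comm F U) (∧•-zeroˡ F)
constant-∧• (just false) (just true)  = ∧•-identityʳ F
constant-∧• (just false) (just false) = ∧•-idem F

constant-∨• : ∀ v w → constant v ∨• constant w ≃ constant (zipWith Bool._∨_ v w)
constant-∨• v w = begin
  constant v ∨• constant w            ≈⟨ ∨•-deMorgan _ _ ⟩
  ¬ (¬ constant v ∧• ¬ constant w)    ≈⟨ ¬-cong (bin-cong and• (constant-¬ v) (constant-¬ w)) ⟩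
  ¬ (constant (Maybe.map not v) ∧• constant (Maybe.map not w))
                                      ≈⟨ ¬-cong (constant-∧• (Maybe.map not v) _) ⟩
  ¬ constant (zipWith Bool._∧_ (Maybe.map not v) (Maybe.map not w))
                                      ≈⟨ constant-¬ (zipWith Bool._∧_ (Maybe.map not v) _) ⟩
  constant (Maybe.map not (zipWith Bool._∧_ (Maybe.map not v) (Maybe.map not w)))
                                      ≡⟨ ≡.cong constant (dualised v w) ⟩
  constant (zipWith Bool._∨_ v w)     ∎
  where
  dualised : ∀ v w → Maybe.map not (zipWith Bool._∧_ (Maybe.map not v) (Maybe.map not w))
                   ≡ zipWith Bool._∨_ v w
  dualised nothing      w              = ≡.refl
  dualised (just _)     nothing        = ≡.refl
  dualised (just true)  (just _)       = ≡.refl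
  dualised (just false) (just true)    = ≡.refl
  dualised (just false) (just false)   = ≡.refl

-- Equality under the assumption `m`. It is compatible with all connectives, so subterms can be
-- evaluated in place.
Under : StrictTerm → StrictTerm → StrictTerm → Set
Under m s r = m ∧• s ≃ m ∧• r

-- The dual of `S8` inserts a copy of `m` beneath the negation, where the hypothesis applies.
under-¬ : ∀ {m s r} → Under m s r → Under m (¬ s) (¬ r)
under-¬ {m} {s} {r} p = ≈-trans (expose s)
  (≈-trans (∧•-congˡ (¬-cong p)) (≈-sym (expose r)))
  where
  expose : ∀ s → m ∧• ¬ s ≃ m ∧• ¬ (m ∧• s)
  expose s = ≈-sym (≈-trans (∧•-congˡ (¬-∧• m s)) (∧•-[¬∨•] m (¬ s)))

under-∧• : ∀ {m s s′ r r′} → Under m s s′ → Under m r r′ →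
  Under m (s ∧• r) (s′ ∧• r′)
under-∧• {m} {s} {s′} {r} {r′} p q = begin
  m ∧• (s ∧• r)      ≈⟨ ∧•-assoc m s r ⟨
  (m ∧• s) ∧• r      ≈⟨ ∧•-congʳ p ⟩
  (m ∧• s′) ∧• r     ≈⟨ ∧•-assoc m s′ r ⟩
  m ∧• (s′ ∧• r)     ≈⟨ ∧•-leftComm m s′ r ⟩
  s′ ∧• (m ∧• r)     ≈⟨ ∧•-congˡ q ⟩
  s′ ∧• (m ∧• r′)    ≈⟨ ∧•-leftComm s′ m r′ ⟩
  m ∧• (s′ ∧• r′)    ∎

under-∨• : ∀ {m s s′ r r′} → Under m s s′ → Under m r r′ →
  Under m (s ∨• r) (s′ ∨• r′)
under-∨• p q = ≈-trans (∧•-distribˡ _ _ _)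
  (≈-trans (∨•-cong p q) (≈-sym (∧•-distribˡ _ _ _)))

literal : ℕ → Bool → StrictTerm
literal i true  = var i
literal i false = ¬ var i

literal-var : ∀ i b → Under (literal i b) (var i) (constant (just b))
literal-var i true  = ≈-trans (∧•-idem _) (≈-sym (∧•-identityʳ _))
literal-var i false = ¬∧•-self (var i)

Cube : Set
Cube = List (ℕ × Bool)

cube : Cube → StrictTerm
cube []            = T
cube ((i , b) ∷ c) = literal i b ∧• cube c

-- A variable repeated in a cube takes the value of its first literal; such a
-- cube may be contradictory, but cube-eval below holds for it all the same.
valuation : Cube → ℕ → Bool
valuation []            j = true
valuation ((i , b) ∷ c) j with i ≟ j
... | yes _ = b
... | no _  = valuation c j

variables : StrictTerm → List ℕ
variables (var i)     = i ∷ []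
variables (con _)     = []
variables (¬ s)       = variables s
variables (bin _ s r) = variables s ++ variables r

cube-var : ∀ c j → j ∈ map proj₁ c →
  Under (cube c) (var j) (constant (just (valuation c j)))
cube-var ((i , b) ∷ c) j j∈c with i ≟ j | j∈c
... | yes ≡.refl | _          = begin
  (literal i b ∧• cube c) ∧• var i                 ≈⟨ swap _ ⟩
  cube c ∧• (literal i b ∧• var i)                 ≈⟨ ∧•-congˡ (literal-var i b) ⟩
  cube c ∧• (literal i b ∧• constant (just b))     ≈⟨ swap _ ⟨
  (literal i b ∧• cube c) ∧• constant (just b)     ∎
  where
  swap : ∀ s → (literal i b ∧• cube c) ∧• s ≃ cube c ∧• (literal i b ∧• s)
  swap s = ≈-trans (∧•-assoc _ _ s) (∧•-leftComm _ _ s)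
... | no i≢j     | here j≡i   = contradiction (≡.sym j≡i) i≢j
... | no _       | there j∈c′ = ≈-trans (∧•-assoc _ _ _)
  (≈-trans (∧•-congˡ (cube-var c j j∈c′)) (≈-sym (∧•-assoc _ _ _)))

cube-eval : ∀ c s → variables s ⊆ map proj₁ c →
  Under (cube c) s (constant (⟦ s ⟧ (just ∘ valuation c)))
cube-eval c (var i) vs = cube-var c i (vs (here ≡.refl))
cube-eval c (con t) vs = ≈-refl
cube-eval c (con f) vs = ≈-refl
cube-eval c (con u) vs = ≈-refl
cube-eval c (¬ s)   vs = ≈-trans (under-¬ (cube-eval c s vs))
  (∧•-congˡ (constant-¬ (⟦ s ⟧ _)))
cube-eval c (bin and• s r) vs = ≈-trans
  (under-∧• (cube-eval c s (vs ∘ ∈-++⁺ˡ))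
            (cube-eval c r (vs ∘ ∈-++⁺ʳ (variables s))))
  (∧•-congˡ (constant-∧• (⟦ s ⟧ _) (⟦ r ⟧ _)))
cube-eval c (bin or• s r)  vs = ≈-trans
  (under-∨• (cube-eval c s (vs ∘ ∈-++⁺ˡ))
            (cube-eval c r (vs ∘ ∈-++⁺ʳ (variables s))))
  (∧•-congˡ (constant-∨• (⟦ s ⟧ _) (⟦ r ⟧ _)))

excluded : ℕ → StrictTerm
excluded i = var i ∨• ¬ var i

allExcluded : List ℕ → StrictTerm
allExcluded []       = T
allExcluded (i ∷ is) = excluded i ∧• allExcluded is

-- Case distinction on one variable: distributivity splits the conjunction with `excluded i` into a
-- disjunction over the two literals.
under-excluded : ∀ i {s r} → (∀ b → Under (literal i b) s r) → Under (excluded i) s r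
under-excluded i {s} {r} p = begin
  excluded i ∧• s                      ≈⟨ split s ⟩
  (s ∧• var i) ∨• (s ∧• ¬ var i)       ≈⟨ ∨•-cong (swapped true) (swapped false) ⟩
  (r ∧• var i) ∨• (r ∧• ¬ var i)       ≈⟨ split r ⟨
  excluded i ∧• r                      ∎
  where
  split : ∀ s → excluded i ∧• s ≃ (s ∧• var i) ∨• (s ∧• ¬ var i)
  split s = ≈-trans (∧•-comm _ s) (∧•-distribˡ s _ _)

  swapped : ∀ b → s ∧• literal i b ≃ r ∧• literal i b
  swapped b = ≈-trans (∧•-comm s _) (≈-trans (p b) (∧•-comm _ r))

under-allExcluded : ∀ is {s r} →
  (∀ c → map proj₁ c ≡ is → Under (cube c) s r) → Under (allExcluded is) s r
under-allExcluded []       p = p [] ≡.refl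
under-allExcluded (i ∷ is) {s} {r} p = ≈-trans (∧•-assoc _ _ s)
  -- The chosen literal is moved into both terms, so that the induction hypothesis applies to `is`;
  -- `step` moves it back into the cube.
  (≈-trans (under-excluded i λ b → ≈-trans (∧•-leftComm _ _ s)
    (≈-trans (under-allExcluded is (step b)) (∧•-leftComm _ _ r)))
  (≈-sym (∧•-assoc _ _ r)))
  where
  step : ∀ b c → map proj₁ c ≡ is → Under (cube c) (literal i b ∧• s) (literal i b ∧• r)
  step b c c≡is = ≈-trans (reorder s)
    (≈-trans (p ((i , b) ∷ c) (≡.cong (i ∷_) c≡is)) (≈-sym (reorder r)))
    where
    reorder : ∀ s → cube c ∧• (literal i b ∧• s) ≃ (literal i b ∧• cube c) ∧• s
    reorder s = ≈-trans (∧•-leftComm _ _ s) (≈-sym (∧•-assoc _ _ s))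

-- Undefinedness and absorption of excluded middles

zipWith-nothingʳ : ∀ {A B C : Set} (g : A → B → C) v → zipWith g v nothing ≡ nothing
zipWith-nothingʳ g nothing  = ≡.refl
zipWith-nothingʳ g (just _) = ≡.refl

zipWith≡nothing : ∀ {A B C : Set} (g : A → B → C) v w →
  zipWith g v w ≡ nothing → v ≡ nothing ⊎ w ≡ nothing
zipWith≡nothing g nothing  w       _ = inj₁ ≡.refl
zipWith≡nothing g (just _) nothing _ = inj₂ ≡.refl

map≡nothing : ∀ {A B : Set} (g : A → B) v → Maybe.map g v ≡ nothing → v ≡ nothing
map≡nothing g nothing _ = ≡.refl

strict : ∀ s {i} → i ∈ variables s → ∀ ρ → ρ i ≡ nothing → ⟦ s ⟧ ρ ≡ nothing
strict (var _) (here ≡.refl) ρ ρi = ρi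
strict (¬ s)   i∈s           ρ ρi = ≡.cong (Maybe.map not) (strict s i∈s ρ ρi)
strict (bin b s r) i∈ ρ ρi with ∈-++⁻ (variables s) i∈
strict (bin and• s r) i∈ ρ ρi | inj₁ i∈s =
  ≡.cong (λ v → zipWith Bool._∧_ v (⟦ r ⟧ ρ)) (strict s i∈s ρ ρi)
strict (bin and• s r) i∈ ρ ρi | inj₂ i∈r = ≡.trans
  (≡.cong (zipWith Bool._∧_ (⟦ s ⟧ ρ)) (strict r i∈r ρ ρi)) (zipWith-nothingʳ _ (⟦ s ⟧ ρ))
strict (bin or• s r)  i∈ ρ ρi | inj₁ i∈s =
  ≡.cong (λ v → zipWith Bool._∨_ v (⟦ r ⟧ ρ)) (strict s i∈s ρ ρi)
strict (bin or• s r)  i∈ ρ ρi | inj₂ i∈r = ≡.trans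
  (≡.cong (zipWith Bool._∨_ (⟦ s ⟧ ρ)) (strict r i∈r ρ ρi)) (zipWith-nothingʳ _ (⟦ s ⟧ ρ))

-- Defined values elsewhere ensure that undefinedness of a term can come only from `i` or from `U`.
undefinedAt : ℕ → ℕ → Value
undefinedAt i j with i ≟ j
... | yes _ = nothing
... | no _  = just true

undefinedAt-self : ∀ i → undefinedAt i i ≡ nothing
undefinedAt-self i with i ≟ i
... | yes _  = ≡.refl
... | no i≢i = contradiction ≡.refl i≢i

-- a ∧• F is F when a is defined and U otherwise, so a Absorbs b says that a is
-- undefined whenever b is.
_Absorbs_ : StrictTerm → StrictTerm → Set
a Absorbs b = a ∧• (b ∧• F) ≃ a ∧• F

-- `a ∧• F` depends only on whether `a` is defined, so negating `a` leaves it unchanged.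
absorbs-¬ : ∀ {a b} → a Absorbs b → (¬ a) Absorbs b
absorbs-¬ {a} {b} p = begin
  ¬ a ∧• (b ∧• F)    ≈⟨ ∧•-leftComm _ _ _ ⟩
  b ∧• (¬ a ∧• F)    ≈⟨ ∧•-congˡ (¬∧•F a) ⟩
  b ∧• (a ∧• F)      ≈⟨ ∧•-leftComm _ _ _ ⟩
  a ∧• (b ∧• F)      ≈⟨ p ⟩
  a ∧• F             ≈⟨ ¬∧•F a ⟨
  ¬ a ∧• F           ∎

absorbs-∧•ʳ : ∀ {a b} c → a Absorbs b → (c ∧• a) Absorbs b
absorbs-∧•ʳ c p = ≈-trans (∧•-assoc _ _ _)
  (≈-trans (∧•-congˡ p) (≈-sym (∧•-assoc _ _ _)))

absorbs-resp : ∀ {a c b} → a ≃ c → a Absorbs b → c Absorbs b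
absorbs-resp a≃c p = ≈-trans (∧•-congʳ (≈-sym a≃c)) (≈-trans p (∧•-congʳ a≃c))

absorbs-∧•ˡ : ∀ {a b} c → a Absorbs b → (a ∧• c) Absorbs b
absorbs-∧•ˡ c p = absorbs-resp (∧•-comm c _) (absorbs-∧•ʳ c p)

absorbs-∨•ˡ : ∀ {a b} c → a Absorbs b → (a ∨• c) Absorbs b
absorbs-∨•ˡ c p = absorbs-resp (≈-sym (∨•-deMorgan _ _))
  (absorbs-¬ (absorbs-∧•ˡ _ (absorbs-¬ p)))

absorbs-∨•ʳ : ∀ {a b} c → a Absorbs b → (c ∨• a) Absorbs b
absorbs-∨•ʳ c p = absorbs-resp (∨•-comm _ c) (absorbs-∨•ˡ c p)

-- The induction follows an undefined subterm down to its source, either `var i` or `U`, and `U`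
-- absorbs everything. This also covers an `i` that does not occur in `s`.
undefined⇒absorbs : ∀ s i → ⟦ s ⟧ (undefinedAt i) ≡ nothing → s Absorbs (var i)
undefined⇒absorbs (var j) i p with i ≟ j | p
... | yes ≡.refl | _ = ≈-trans (≈-sym (∧•-assoc _ _ _)) (∧•-congʳ (∧•-idem _))
... | no _       | ()
undefined⇒absorbs (con u) i p = ≈-trans (∧•-zeroˡ _) (≈-sym (∧•-zeroˡ _))
undefined⇒absorbs (¬ s)   i p =
  absorbs-¬ {s} (undefined⇒absorbs s i (map≡nothing not _ p))
undefined⇒absorbs (bin and• s r) i p with zipWith≡nothing _ (⟦ s ⟧ _) _ p
... | inj₁ q = absorbs-∧•ˡ r (undefined⇒absorbs s i q)
... | inj₂ q = absorbs-∧•ʳ s (undefined⇒absorbs r i q)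
undefined⇒absorbs (bin or• s r)  i p with zipWith≡nothing _ (⟦ s ⟧ _) _ p
... | inj₁ q = absorbs-∨•ˡ r (undefined⇒absorbs s i q)
... | inj₂ q = absorbs-∨•ʳ s (undefined⇒absorbs r i q)

-- This puts an excluded middle into a form containing `a ∧• F`, on which `Absorbs` can act after
-- distribution.
T∨•[∧•F] : ∀ a → T ∨• (a ∧• F) ≃ a ∨• ¬ a
T∨•[∧•F] a = begin
  T ∨• (a ∧• F)                ≈⟨ ∨•-deMorgan _ _ ⟩
  ¬ (¬ T ∧• ¬ (a ∧• F))        ≈⟨ ¬-cong (bin-cong and• (axiom s1) ¬[a∧•F]) ⟩
  ¬ (F ∧• (¬ a ∨• a))          ≈⟨ ¬-cong (∧•-distribˡ F (¬ a) a) ⟩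
  ¬ ((F ∧• ¬ a) ∨• (F ∧• a))   ≈⟨ ¬-cong (∨•-cong (≈-trans (∧•-comm _ _) (¬∧•F a)) (∧•-comm _ _)) ⟩
  ¬ ((a ∧• F) ∨• (a ∧• F))     ≈⟨ ¬-cong (∨•-idem _) ⟩
  ¬ (a ∧• F)                   ≈⟨ ¬[a∧•F] ⟩
  ¬ a ∨• a                     ≈⟨ ∨•-comm _ _ ⟩
  a ∨• ¬ a                     ∎
  where
  ¬[a∧•F] : ¬ (a ∧• F) ≃ ¬ a ∨• a
  ¬[a∧•F] = ≈-trans (¬-∧• a F) (≈-trans (∨•-cong ≈-refl ¬F≃T) (¬∨•T a))

absorbs⇒excluded : ∀ {a b} → a Absorbs b → (b ∨• ¬ b) ∧• a ≃ a
absorbs⇒excluded {a} {b} p = begin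
  (b ∨• ¬ b) ∧• a                 ≈⟨ ∧•-comm _ a ⟩
  a ∧• (b ∨• ¬ b)                 ≈⟨ ∧•-congˡ (T∨•[∧•F] b) ⟨
  a ∧• (T ∨• (b ∧• F))            ≈⟨ ∧•-distribˡ a T _ ⟩
  (a ∧• T) ∨• (a ∧• (b ∧• F))     ≈⟨ ∨•-cong ≈-refl p ⟩
  (a ∧• T) ∨• (a ∧• F)            ≈⟨ ∧•-distribˡ a T F ⟨
  a ∧• (T ∨• F)                   ≈⟨ ∧•-congˡ (∨•-identityʳ T) ⟩
  a ∧• T                          ≈⟨ ∧•-identityʳ a ⟩
  a                               ∎

allExcluded-∧• : ∀ is s → (∀ i → i ∈ is → s Absorbs (var i)) → allExcluded is ∧• s ≃ s
allExcluded-∧• []       s p = ∧•-identityˡ s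
allExcluded-∧• (i ∷ is) s p = ≈-trans (∧•-assoc _ _ s)
  (≈-trans (∧•-congˡ (allExcluded-∧• is s λ j j∈is → p j (there j∈is)))
    (absorbs⇒excluded (p i (here ≡.refl))))

complete : ∀ {e} → BochvarValid e → StrictAxioms ⊢ e
complete {s ≈ r} valid = begin
  s                       ≈⟨ allExcluded-∧• is s (λ i → undefined⇒absorbs s i ∘ s-undefined i) ⟨
  allExcluded is ∧• s     ≈⟨ under-allExcluded is agree ⟩
  allExcluded is ∧• r     ≈⟨ allExcluded-∧• is r (λ i i∈ → undefined⇒absorbs r i
                               (≡.trans (≡.sym (valid _)) (s-undefined i i∈))) ⟩
  r                       ∎
  where
  is : List ℕ
  -- A cube has to fix the variables of both sides in order to evaluate both.
  is = variables s ++ variables r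

  s-undefined : ∀ i → i ∈ is → ⟦ s ⟧ (undefinedAt i) ≡ nothing
  s-undefined i i∈ with ∈-++⁻ (variables s) i∈
  ... | inj₁ i∈s = strict s i∈s _ (undefinedAt-self i)
  -- Here `i` comes from `r`, and validity transfers the undefinedness of `r` to `s`.
  ... | inj₂ i∈r = ≡.trans (valid _) (strict r i∈r _ (undefinedAt-self i))

  agree : ∀ c → map proj₁ c ≡ is → Under (cube c) s r
  agree c c≡is = begin
    cube c ∧• s                                   ≈⟨ cube-eval c s (⊆-dom ∘ ∈-++⁺ˡ) ⟩
    cube c ∧• constant (⟦ s ⟧ (just ∘ valuation c))  ≡⟨ ≡.cong (λ v → cube c ∧• constant v) (valid _) ⟩
    cube c ∧• constant (⟦ r ⟧ (just ∘ valuation c))  ≈⟨ cube-eval c r (⊆-dom ∘ ∈-++⁺ʳ (variables s)) ⟨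
    cube c ∧• r                                   ∎
    where
    ⊆-dom : is ⊆ map proj₁ c
    ⊆-dom = ≡.subst (_ ∈_) (≡.sym c≡is)

mainTheorem5 :
    ( (CL₃⟨∧•,∨•⟩ ⊢ S1)
    × (CL₃⟨∧•,∨•⟩ ⊢ S2)
    × (CL₃⟨∧•,∨•⟩ ⊢ S3)
    × (CL₃⟨∧•,∨•⟩ ⊢ S4)
    × (CL₃⟨∧•,∨•⟩ ⊢ S6)
    × (CL₃⟨∧•,∨•⟩ ⊢ S7)
    × (CL₃⟨∧•,∨•⟩ ⊢ S8)
    × (CL₃⟨∧•,∨•⟩ ⊢ S9)
    × (CL₃⟨∧•,∨•⟩ ⊢ S10)
    × (CL₃⟨∧•,∨•⟩ ⊢ S11) )
    × (∀ e → (StrictAxioms ⊢ e) ⇔ BochvarValid e)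
    × ( (CL₂⟨∧•,∨•⟩ ⊢ S1)
      × (CL₂⟨∧•,∨•⟩ ⊢ S3)
      × (CL₂⟨∧•,∨•⟩ ⊢ S4)
      × (CL₂⟨∧•,∨•⟩ ⊢ S6)
      × (CL₂⟨∧•,∨•⟩ ⊢ S7)
      × (CL₂⟨∧•,∨•⟩ ⊢ S8)
      × (CL₂⟨∧•,∨•⟩ ⊢ S9) )
    × ( (CL⟨∧•,∨•⟩ ⊢ S3)
      × (CL⟨∧•,∨•⟩ ⊢ S4)
      × (CL⟨∧•,∨•⟩ ⊢ S8)
      × (CL⟨∧•,∨•⟩ ⊢ S9)
      × (CL⟨∧•,∨•⟩ ⊢ S10) )
mainTheorem5 =
    ( CL₃-.S1-derivable , FullCL₃.S2-derivable , CL₃•.S3-derivable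
    , CL₃•.S4-derivable , CL₃•.S6-derivable , CL₃-.S7-derivable
    , CL₃•.S8-derivable , CL₃•.S9-derivable , CL₃•.S10-derivable
    , FullCL₃.S11-derivable )
  , (λ e → mk⇔ sound complete)
  , ( CL₂-.S1-derivable , CL₂•.S3-derivable , CL₂•.S4-derivable
    , CL₂•.S6-derivable , CL₂-.S7-derivable , CL₂•.S8-derivable
    , CL₂•.S9-derivable )
  , ( CL•.S3-derivable , CL•.S4-derivable , CL•.S8-derivable
    , CL•.S9-derivable , CL•.S10-derivable )
  where
  module CL•  = FullCL {Th = CL} id
  module CL₂• = FullCL {Th = CL₂} CL₂.cl
  module CL₃• = FullCL {Th = CL₃} (cl₂ ∘ CL₂.cl)
  module CL₂- = FullCL₂ {Th = CL₂} id
  module CL₃- = FullCL₂ {Th = CL₃} cl₂
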